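{- Let $Z$ and $X$ be as in the context. Then $Z^{ -1}=XZX$. In particular, $Z^{ -1}\in\mathcal{DR}_0$.
   Context: $\mathbf N=\{1,2,\dots\}$. For $k,m\in\mathbf N$, $\alpha_k(m)$ is the number of $k$-tuples $(m_1,\dots,m_k)$ of integers $\ge2$ with $m_1\cdots m_k=m$. The divisor matrix $D=(d_{i,j})_{i,j\in\mathbf N}$ has $d_{i,j}=1$ if $i\mid j$ and $0$ otherwise. $Z=(\alpha(i,j))_{i,j\in\mathbf N}$ is the matrix whose odd-indexed rows have a single nonzero entry, equal to $1$, on the diagonal, and whose $i$-th row, for $i=2^kd$ with $d$ odd and $k\ge1$, equals the $d$-th row of $(D-I)^k$ (equivalently $\alpha(i,j)=\alpha_k(j/d)$ if $d\mid j$ and $0$ otherwise). $Z$ is upper unitriangular. $v_2(i)$ is the exponent of $2$ in $i$, and $X$ is the diagonal matrix with $(i,i)$ entry $(-1)^{v_2(i)}$. $\mathcal{DR}_0$ is the set of $\mathbf N\times\mathbf N$ complex matrices $A=(a_{i,j})$ for which there exist positive constants $C,c$ with $a_{i,j}=0$ whenever $i>Cj^c$ and $|a_{i,j}|\le Cj^c$ for all $i,j$. -}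

module Defs where

open import Algebra.Bundles using (CommutativeRing; Semiring)
import Algebra.Definitions.RawSemiring as RawSemiringDefinitions
import Algebra.Properties.Ring as RingProperties
import Algebra.Properties.Semiring.Sum as SemiringSum
import Algebra.Solver.Ring.NaturalCoefficients.Default as SemiringSolver
open import Data.Fin.Base using (toℕ)
open import Data.Fin.Properties using (toℕ<n)
open import Data.Nat.Base as ℕ using (ℕ; zero; suc; pred; s≤s)
open import Data.Nat.Divisibility using (_∣_; _∣?_; divides; 1∣_; ∣-refl; ∣⇒≤)
import Data.Nat.DivMod as DivMod
import Data.Nat.Properties as ℕₚ
open import Data.Product.Base using (_×_; _,_; proj₁; proj₂; ∃-syntax)
open import Level using (_⊔_) renaming (suc to lsuc)
open import Relation.Binary.Core using (Rel)
open import Relation.Binary.PropositionalEquality as ≡ using (_≡_)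
open import Relation.Binary.Structures using (IsPartialOrder)
open import Relation.Nullary using (¬_; Dec; yes; no; contradiction)

------------------------------------------------------------------------
-- The exponent of 2 and the odd part

-- The largest k ≤ b with 2 ^ k ∣ n.
v₂-upTo : ℕ → ℕ → ℕ
v₂-upTo n zero    = 0
v₂-upTo n (suc b) with 2 ℕ.^ suc b ∣? n
... | yes _ = suc b
... | no  _ = v₂-upTo n b

-- Since n < 2 ^ n, searching up to n finds the exact exponent for n ≥ 1.
v₂ : ℕ → ℕ
v₂ n = v₂-upTo n n

oddPart : ℕ → ℕ
oddPart n = DivMod._/_ n (2 ℕ.^ v₂ n) ⦃ ℕₚ.m^n≢0 2 (v₂ n) ⦄

2^v₂∣n : ∀ n → 2 ℕ.^ v₂ n ∣ n
2^v₂∣n n = go n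
  where
  go : ∀ b → 2 ℕ.^ v₂-upTo n b ∣ n
  go zero    = 1∣ n
  go (suc b) with 2 ℕ.^ suc b ∣? n
  ... | yes p = p
  ... | no  _ = go b

2^v₂*oddPart≡n : ∀ n → 2 ℕ.^ v₂ n ℕ.* oddPart n ≡ n
2^v₂*oddPart≡n n =
  DivMod.m*[n/m]≡n ⦃ ℕₚ.m^n≢0 2 (v₂ n) ⦄ (2^v₂∣n n)

maxUpTo : (ℕ → ℕ) → ℕ → ℕ
maxUpTo f zero    = 0
maxUpTo f (suc n) = maxUpTo f n ℕ.⊔ f n

f≤maxUpTo : ∀ f {n k} → k ℕ.< n → f k ℕ.≤ maxUpTo f n
f≤maxUpTo f {suc n} {k} (s≤s k≤n) with k ℕₚ.≟ n
... | yes ≡.refl = ℕₚ.m≤n⊔m (maxUpTo f n) (f n)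
... | no  k≢n    = ℕₚ.≤-trans (f≤maxUpTo f (ℕₚ.≤∧≢⇒< k≤n k≢n)) (ℕₚ.m≤m⊔n _ (f n))

------------------------------------------------------------------------
-- Matrices with rows and columns indexed by {1, 2, …}
--
-- Indices are shifted: `entry A i j` is the entry in row `suc i` and
-- column `suc j`.

module Matrices {c ℓ} (K : CommutativeRing c ℓ) where

  open CommutativeRing K
  open RawSemiringDefinitions (Semiring.rawSemiring semiring) using (_^_)
  open SemiringSum semiring using (sum; sum-cong-≋; sum-replicate-zero)

  infix 5 _when_
  _when_ : ∀ {p} {P : Set p} → Carrier → Dec P → Carrier
  x when yes _ = x
  x when no  _ = 0#

  -- Every column has only finitely many nonzero entries, so that all
  -- the sums in a product are finite.
  record Matrix : Set (c ⊔ ℓ) where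
    field
      entry  : ℕ → ℕ → Carrier
      bound  : ℕ → ℕ
      vanish : ∀ {i j} → bound j ℕ.≤ i → entry i j ≈ 0#

  open Matrix public

  -- The chosen bounds are irrelevant to equality.
  infix 4 _≋_
  _≋_ : Rel Matrix ℓ
  A ≋ B = ∀ i j → entry A i j ≈ entry B i j

  sum-zero : ∀ n {f} → (∀ k → f k ≈ 0#) → sum {n} f ≈ 0#
  sum-zero n f≈0 = trans (sum-cong-≋ f≈0) (sum-replicate-zero n)

  infixl 7 _⊗_
  _⊗_ : Matrix → Matrix → Matrix
  entry  (A ⊗ B) i j =
    sum {bound B j} (λ k → entry A i (toℕ k) * entry B (toℕ k) j)
  bound  (A ⊗ B) j   = maxUpTo (bound A) (bound B j)
  vanish (A ⊗ B) {i} {j} b≤i = sum-zero (bound B j) λ k →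
    trans (*-congʳ (vanish A (ℕₚ.≤-trans (f≤maxUpTo (bound A) (toℕ<n k)) b≤i)))
          (zeroˡ _)

  infixl 6 _⊖_
  _⊖_ : Matrix → Matrix → Matrix
  entry  (A ⊖ B) i j = entry A i j - entry B i j
  bound  (A ⊖ B) j   = bound A j ℕ.⊔ bound B j
  vanish (A ⊖ B) {i} {j} b≤i = trans
    (+-cong (vanish A (ℕₚ.≤-trans (ℕₚ.m≤m⊔n _ _) b≤i))
            (-‿cong (vanish B (ℕₚ.≤-trans (ℕₚ.m≤n⊔m (bound A j) _) b≤i))))
    (-‿inverseʳ 0#)

  diagonal : (ℕ → Carrier) → Matrix
  entry  (diagonal f) i j = f i when (i ℕₚ.≟ j)
  bound  (diagonal f) j   = suc j
  vanish (diagonal f) {i} {j} j<i with i ℕₚ.≟ j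
  ... | yes ≡.refl = contradiction j<i (ℕₚ.<-irrefl ≡.refl)
  ... | no  _      = refl

  I : Matrix
  I = diagonal (λ _ → 1#)

  infixr 8 _⊗^_
  _⊗^_ : Matrix → ℕ → Matrix
  A ⊗^ zero  = I
  A ⊗^ suc k = (A ⊗^ k) ⊗ A

  IsInverse : Rel Matrix ℓ
  IsInverse A B = A ⊗ B ≋ I × B ⊗ A ≋ I

  D : Matrix
  entry  D i j = 1# when (suc i ∣? suc j)
  bound  D j   = suc j
  vanish D {i} {j} j<i with suc i ∣? suc j
  ... | yes p = contradiction (ℕₚ.<-≤-trans (s≤s j<i) (∣⇒≤ p)) (ℕₚ.<-irrefl ≡.refl)
  ... | no  _ = refl

  D-I : Matrix
  D-I = D ⊖ I

  X : Matrix
  X = diagonal (λ i → (- 1#) ^ v₂ (suc i))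

  -- Row suc i = 2 ^ k * d, given k = v₂ (suc i); the shifted index of
  -- row d is pred d.
  Z-row : (k i j : ℕ) → Carrier
  Z-row zero    i j = entry I i j
  Z-row (suc k) i j = entry (D-I ⊗^ suc k) (pred (oddPart (suc i))) j

  D-I-vanish : ∀ i j → suc j ℕ.< 2 ℕ.* suc i → entry D-I i j ≈ 0#
  D-I-vanish i j j<2i with i ℕₚ.≟ j | suc i ∣? suc j
  ... | yes ≡.refl | yes _   = -‿inverseʳ 1#
  ... | yes ≡.refl | no  i∤i = contradiction ∣-refl i∤i
  ... | no  _      | no  _   = -‿inverseʳ 0#
  ... | no  i≢j    | yes (divides q eq) = contradiction j<2i (go q eq)
    where
    go : ∀ q → suc j ≡ q ℕ.* suc i → ¬ (suc j ℕ.< 2 ℕ.* suc i)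
    go zero          ()
    go (suc zero)    eq _  =
      i≢j (≡.sym (ℕₚ.suc-injective (≡.trans eq (ℕₚ.*-identityˡ (suc i)))))
    go (suc (suc q)) eq lt = ℕₚ.<⇒≱ lt
      (ℕₚ.≤-trans (ℕₚ.*-monoˡ-≤ (suc i) (s≤s (s≤s (ℕ.z≤n {q})))) (ℕₚ.≤-reflexive (≡.sym eq)))

  power-vanish : ∀ k i j → suc j ℕ.< 2 ℕ.^ k ℕ.* suc i → entry (D-I ⊗^ k) i j ≈ 0#
  power-vanish zero    i j lt = vanish I (ℕ.s≤s⁻¹ (≡.subst (suc j ℕ.<_) (ℕₚ.*-identityˡ (suc i)) lt))
  power-vanish (suc k) i j lt = sum-zero (bound D-I j) λ m → term (toℕ m)
    where
    term : ∀ m → entry (D-I ⊗^ k) i m * entry D-I m j ≈ 0#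
    term m with suc j ℕₚ.<? 2 ℕ.* suc m
    ... | yes j<2m = trans (*-congˡ (D-I-vanish m j j<2m)) (zeroʳ _)
    ... | no  j≮2m = trans (*-congʳ (power-vanish k i m m<2ᵏi)) (zeroˡ _)
      where
      m<2ᵏi : suc m ℕ.< 2 ℕ.^ k ℕ.* suc i
      m<2ᵏi = ℕₚ.*-cancelˡ-< 2 _ _ (ℕₚ.≤-<-trans (ℕₚ.≮⇒≥ j≮2m)
        (≡.subst (suc j ℕ.<_) (ℕₚ.*-assoc 2 (2 ℕ.^ k) (suc i)) lt))

  Z : Matrix
  entry  Z i j = Z-row (v₂ (suc i)) i j
  bound  Z j   = suc j
  vanish Z {i} {j} j<i = go (v₂ (suc i)) ≡.refl
    where
    d = oddPart (suc i)

    positive : ∀ k → 2 ℕ.^ k ℕ.* d ≡ suc i → suc (pred d) ≡ d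
    positive k eq with d
    ... | suc _ = ≡.refl
    ... | zero  = contradiction (≡.trans (≡.sym eq) (ℕₚ.*-zeroʳ (2 ℕ.^ k))) λ ()

    factor : 2 ℕ.^ v₂ (suc i) ℕ.* d ≡ suc i
    factor = 2^v₂*oddPart≡n (suc i)

    go : ∀ k → v₂ (suc i) ≡ k → Z-row k i j ≈ 0#
    go zero    _  = vanish I j<i
    go (suc k) eq = power-vanish (suc k) (pred d) j
      (≡.subst (suc j ℕ.<_) (≡.sym row) (s≤s j<i))
      where
      factor′ : 2 ℕ.^ suc k ℕ.* d ≡ suc i
      factor′ = ≡.trans (≡.cong (λ v → 2 ℕ.^ v ℕ.* d) (≡.sym eq)) factor
      row : 2 ℕ.^ suc k ℕ.* suc (pred d) ≡ suc i
      row = ≡.trans (≡.cong (2 ℕ.^ suc k ℕ.*_) (positive (suc k) factor′)) factor′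

------------------------------------------------------------------------
-- Real and complex scalars

-- The library has no real numbers.  The only structure of ℝ used below
-- is that of a nontrivial ordered commutative ring, so the real scalars
-- are an arbitrary such ring.
record OrderedRing c ℓ₁ ℓ₂ : Set (lsuc (c ⊔ ℓ₁ ⊔ ℓ₂)) where
  field
    commutativeRing : CommutativeRing c ℓ₁

  open CommutativeRing commutativeRing public

  infix 4 _≤_ _<_
  field
    _≤_            : Rel Carrier ℓ₂
    isPartialOrder : IsPartialOrder _≈_ _≤_
    +-monoˡ-≤      : ∀ z {x y} → x ≤ y → x + z ≤ y + z
    *-nonNegative  : ∀ {x y} → 0# ≤ x → 0# ≤ y → 0# ≤ x * y
    0≤1            : 0# ≤ 1#
    0≉1            : ¬ 0# ≈ 1#

  _<_ : Rel Carrier (ℓ₁ ⊔ ℓ₂)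
  x < y = x ≤ y × ¬ x ≈ y

module Complex {c ℓ₁ ℓ₂} (R : OrderedRing c ℓ₁ ℓ₂) where

  open OrderedRing R
  open RawSemiringDefinitions (Semiring.rawSemiring semiring) using (_^_) renaming (_×_ to _·_)

  open RingProperties ring using (-0#≈0#; -1*x≈-x)

  -- The ring of numbers x + yi, represented as (x , y).
  ℂ : CommutativeRing c ℓ₁
  ℂ = record
    { Carrier = Carrier × Carrier
    ; _≈_     = λ (x , y) (u , v) → x ≈ u × y ≈ v
    ; _+_     = λ (x , y) (u , v) → x + u , y + v
    ; _*_     = λ (x , y) (u , v) → x * u - y * v , x * v + y * u
    ; -_      = λ (x , y) → - x , - y
    ; 0#      = 0# , 0#
    ; 1#      = 1# , 0#
    ; isCommutativeRing = record
      { isRing = record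
        { +-isAbelianGroup = record
          { isGroup = record
            { isMonoid = record
              { isSemigroup = record
                { isMagma = record
                  { isEquivalence = record
                    { refl  = refl , refl
                    ; sym   = λ (p , q) → sym p , sym q
                    ; trans = λ (p , q) (r , s) → trans p r , trans q s
                    }
                  ; ∙-cong = λ (p , q) (r , s) → +-cong p r , +-cong q s
                  }
                ; assoc = λ _ _ _ → +-assoc _ _ _ , +-assoc _ _ _
                }
              ; identity = (λ _ → +-identityˡ _ , +-identityˡ _)
                         , (λ _ → +-identityʳ _ , +-identityʳ _)
              }
            ; inverse = (λ _ → -‿inverseˡ _ , -‿inverseˡ _)
                      , (λ _ → -‿inverseʳ _ , -‿inverseʳ _)
            ; ⁻¹-cong = λ (p , q) → -‿cong p , -‿cong q
            }
          ; comm = λ _ _ → +-comm _ _ , +-comm _ _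
          }
        ; *-cong = λ (p , q) (r , s) →
            +-cong (*-cong p r) (-‿cong (*-cong q s)) ,
            +-cong (*-cong p s) (*-cong q r)
        ; *-assoc = *-assoc-ℂ
        ; *-identity =
            *-identityˡ-ℂ ,
            (λ x → ≈ℂ-trans (*-comm-ℂ x (1# , 0#)) (*-identityˡ-ℂ x))
        ; distrib = distribˡ-ℂ , λ x y z →
            ≈ℂ-trans (*-comm-ℂ (y ⊞ z) x) (≈ℂ-trans (distribˡ-ℂ x y z)
              (+-cong (proj₁ (*-comm-ℂ x y)) (proj₁ (*-comm-ℂ x z)) ,
               +-cong (proj₂ (*-comm-ℂ x y)) (proj₂ (*-comm-ℂ x z))))
        }
      ; *-comm = *-comm-ℂ
      }
    }
    where
    infix 4 _≈ℂ_
    _≈ℂ_ : Rel (Carrier × Carrier) ℓ₁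
    (x , y) ≈ℂ (u , v) = x ≈ u × y ≈ v

    ≈ℂ-trans : ∀ {x y z} → x ≈ℂ y → y ≈ℂ z → x ≈ℂ z
    ≈ℂ-trans (p , q) (r , s) = trans p r , trans q s

    _⊞_ _⊠_ : (x y : Carrier × Carrier) → Carrier × Carrier
    (x , y) ⊞ (u , v) = x + u , y + v
    (x , y) ⊠ (u , v) = x * u - y * v , x * v + y * u

    open SemiringSolver commutativeSemiring using (solve; _:+_; _:*_; _:=_)

    -- With - 1# treated as a variable, the remaining laws are identities
    -- in commutative semirings.
    i² : ∀ p q → p - q ≈ p + - 1# * q
    i² p q = +-congˡ (sym (-1*x≈-x q))

    *-comm-ℂ : ∀ x y → x ⊠ y ≈ℂ y ⊠ x
    *-comm-ℂ (x , y) (u , v) =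
      +-cong (*-comm x u) (-‿cong (*-comm y v)) ,
      trans (+-comm _ _) (+-cong (*-comm y u) (*-comm x v))

    *-identityˡ-ℂ : ∀ x → (1# , 0#) ⊠ x ≈ℂ x
    *-identityˡ-ℂ (x , y) =
      trans (+-cong (*-identityˡ x) (trans (-‿cong (zeroˡ y)) -0#≈0#)) (+-identityʳ x) ,
      trans (+-cong (*-identityˡ y) (zeroˡ x)) (+-identityʳ y)

    distribˡ-ℂ : ∀ x y z → x ⊠ (y ⊞ z) ≈ℂ (x ⊠ y) ⊞ (x ⊠ z)
    distribˡ-ℂ (a , b) (c , d) (e , f) =
      trans (i² _ _) (trans
        (solve 7 (λ s a b c d e f →
          a :* (c :+ e) :+ s :* (b :* (d :+ f))
          := (a :* c :+ s :* (b :* d)) :+ (a :* e :+ s :* (b :* f)))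
          refl (- 1#) a b c d e f)
        (sym (+-cong (i² _ _) (i² _ _)))) ,
      solve 6 (λ a b c d e f →
        a :* (d :+ f) :+ b :* (c :+ e)
        := (a :* d :+ b :* c) :+ (a :* f :+ b :* e))
        refl a b c d e f

    *-assoc-ℂ : ∀ x y z → (x ⊠ y) ⊠ z ≈ℂ x ⊠ (y ⊠ z)
    *-assoc-ℂ (a , b) (c , d) (e , f) =
      trans (trans (i² _ _) (+-congʳ (*-congʳ (i² _ _)))) (trans
        (solve 7 (λ s a b c d e f →
          (a :* c :+ s :* (b :* d)) :* e :+ s :* ((a :* d :+ b :* c) :* f)
          := a :* (c :* e :+ s :* (d :* f)) :+ s :* (b :* (c :* f :+ d :* e)))
          refl (- 1#) a b c d e f)
        (sym (trans (i² _ _) (+-congʳ (*-congˡ (i² _ _)))))) ,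
      trans (+-congʳ (*-congʳ (i² _ _))) (trans
        (solve 7 (λ s a b c d e f →
          (a :* c :+ s :* (b :* d)) :* f :+ (a :* d :+ b :* c) :* e
          := a :* (c :* f :+ d :* e) :+ b :* (c :* e :+ s :* (d :* f)))
          refl (- 1#) a b c d e f)
        (sym (+-congˡ (*-congˡ (i² _ _)))))

  -- ∣ x + yi ∣ ≤ r, stated without a square root.
  ∣_∣≤_ : Carrier × Carrier → Carrier → Set ℓ₂
  ∣ x , y ∣≤ r = 0# ≤ r × x * x + y * y ≤ r * r

  fromℕ : ℕ → Carrier
  fromℕ n = n · 1#

  open Matrices ℂ public

  -- As j ≥ 1, the powers j ^ c increase with c, so it makes no
  -- difference whether the exponent is a positive real or a positive
  -- integer.  The row index is suc i and the column index is suc j.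
  DR₀ : Matrix → Set (c ⊔ ℓ₁ ⊔ ℓ₂)
  DR₀ A = ∃[ C ] ∃[ e ] 0# < C × 0 ℕ.< e × (∀ i j →
      (C * fromℕ (suc j) ^ e < fromℕ (suc i) →
        CommutativeRing._≈_ ℂ (entry A i j) (CommutativeRing.0# ℂ))
    × ∣ entry A i j ∣≤ (C * fromℕ (suc j) ^ e))

{-# OPTIONS --safe #-}

-- Let S be the matrix with S(i , j) = 1 if j = 2i and 0 otherwise, N = D − I
-- and Y = X Z.  Then S D = D S, S X = − X S and S Z = Z N, so S Y = − Y N.
-- A matrix A with S A = A T for a given T is determined by its odd rows.
--
-- First, D Y = Y (I − S): both sides satisfy S A = A (− N), and their odd rows
-- are compared after multiplying by D on the right.  Indeed
-- D Y D = D (I − S) Y; an odd row of D (I − S) vanishes in the even columns,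
-- and the odd rows of Y are those of I, so that such a row agrees with that of
-- D (I − S) = (I − S) D, hence with that of Y (I − S) D.
--
-- It follows that N P = P S for P = X Z X, so S (Z P) = (Z P) S; as Z P has
-- the odd rows of I, it equals I.  Since X² = I, also P Z = I.
--
-- The entries of the powers of N in column j are natural numbers of size at
-- most j², by induction on the power, because the squares of the proper
-- divisors of j add up to at most j².
module Submission where

open import Algebra.Bundles using (CommutativeRing; Ring)
import Algebra.Properties.Ring as RingProperties
import Algebra.Properties.Semiring.Exp as SemiringExp
import Algebra.Properties.Semiring.Mult as SemiringMult
import Algebra.Properties.Semiring.Sum as SemiringSum
open import Data.Fin.Base using (toℕ)
open import Data.Fin.Properties using (toℕ<n; toℕ-inject₁; toℕ-fromℕ)
open import Data.Nat.Base as ℕ using (ℕ; zero; suc; pred; s≤s; z≤n)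
open import Data.Nat.Divisibility
open import Data.Nat.Induction using (<-rec)
open import Data.Nat.Primality using (prime[2]; euclidsLemma)
import Data.Nat.Properties as ℕₚ
open import Data.Nat.Tactic.RingSolver using (solve-∀)
open import Data.Product.Base using (_×_; _,_; proj₁; proj₂; ∃-syntax)
open import Data.Sum.Base using (_⊎_; inj₁; inj₂)
open import Function.Base using (_∘_)
open import Level using (Level; _⊔_)
open import Relation.Binary.PropositionalEquality as ≡ using (_≡_; _≢_)
import Relation.Binary.Reasoning.Setoid as SetoidReasoning
open import Relation.Binary.Structures using (IsPartialOrder)
open import Relation.Nullary using (¬_; Dec; yes; no; contradiction)
open import Defs

-- Doubling, parity and the exponent of 2.

-- Doubling in shifted indices: suc (dbl i) is 2 * suc i definitionally.
dbl : ℕ → ℕ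
dbl i = i ℕ.+ 1 ℕ.* suc i

-- Indexed by the number itself, so that matching on `even m` turns the index into `dbl m`, the form
-- in which `S-⊗` and `⊗-S-even` apply.
data Parity : ℕ → Set where
  odd  : ∀ {i} → ¬ 2 ∣ suc i → Parity i
  even : ∀ m → Parity (dbl m)

parity : ∀ i → Parity i
parity i with 2 ∣? suc i
... | no  2∤i                = odd 2∤i
... | yes (divides (suc m) eq)
  with ≡.refl ← ℕₚ.suc-injective (≡.trans eq (ℕₚ.*-comm (suc m) 2)) = even m

i<dbl : ∀ i → i ℕ.< dbl i
i<dbl i = ℕₚ.m<m+n i (s≤s z≤n)

dbl-injective : ∀ {i j} → dbl i ≡ dbl j → i ≡ j
dbl-injective {i} {j} eq = ℕₚ.suc-injective (ℕₚ.*-cancelˡ-≡ (suc i) (suc j) 2 (≡.cong suc eq))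

2∣suc-dbl : ∀ i → 2 ∣ suc (dbl i)
2∣suc-dbl i = m∣m*n (suc i)

-- By Euclid's lemma the factor 2 must divide the quotient `q`, from which it is then cancelled.
odd-∣-double : ∀ {d} m → ¬ 2 ∣ d → d ∣ 2 ℕ.* m → d ∣ m
odd-∣-double {d} m 2∤d (divides q eq)
  with euclidsLemma q d prime[2] (≡.subst (2 ∣_) eq (m∣m*n m))
... | inj₂ 2∣d = contradiction 2∣d 2∤d
... | inj₁ (divides r ≡.refl) = divides r (ℕₚ.*-cancelˡ-≡ m (r ℕ.* d) 2
  (≡.trans eq (≡.trans (≡.cong (ℕ._* d) (ℕₚ.*-comm r 2)) (ℕₚ.*-assoc 2 r d))))

n<2^n : ∀ n → n ℕ.< 2 ℕ.^ n
n<2^n zero    = s≤s z≤n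
n<2^n (suc n) = ℕₚ.+-mono-≤-< (ℕₚ.m^n>0 2 n) (≡.subst (n ℕ.<_) (≡.sym (ℕₚ.+-identityʳ _)) (n<2^n n))

v₂-upTo-max : ∀ n b {k} → k ℕ.≤ b → 2 ℕ.^ k ∣ n → k ℕ.≤ v₂-upTo n b
v₂-upTo-max n zero    k≤b _ = k≤b
v₂-upTo-max n (suc b) {k} k≤b 2ᵏ∣n with 2 ℕ.^ suc b ∣? n
... | yes _ = k≤b
... | no  ∤n with k ℕₚ.≟ suc b
...   | yes ≡.refl = contradiction 2ᵏ∣n ∤n
...   | no  k≢b    = v₂-upTo-max n b (ℕ.s≤s⁻¹ (ℕₚ.≤∧≢⇒< k≤b k≢b)) 2ᵏ∣n

v₂-max : ∀ i {k} → 2 ℕ.^ k ∣ suc i → k ℕ.≤ v₂ (suc i)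
v₂-max i {k} 2ᵏ∣i =
  -- The search limit `suc i` is high enough, since k < 2 ^ k ≤ suc i.
  v₂-upTo-max (suc i) (suc i) (ℕₚ.≤-trans (ℕₚ.<⇒≤ (n<2^n k)) (∣⇒≤ 2ᵏ∣i)) 2ᵏ∣i

v₂-dbl : ∀ i → v₂ (suc (dbl i)) ≡ suc (v₂ (suc i))
v₂-dbl i = ℕₚ.≤-antisym (upper (v₂ (suc (dbl i))) (2^v₂∣n (suc (dbl i))))
                        (v₂-max (dbl i) (*-monoʳ-∣ 2 (2^v₂∣n (suc i))))
  where
  upper : ∀ k → 2 ℕ.^ k ∣ 2 ℕ.* suc i → k ℕ.≤ suc (v₂ (suc i))
  upper zero    _ = z≤n
  upper (suc k) p = s≤s (v₂-max i (*-cancelˡ-∣ 2 p))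

v₂-odd : ∀ {n} → ¬ 2 ∣ n → v₂ n ≡ 0
v₂-odd {n} 2∤n with v₂ n | 2^v₂∣n n
... | zero  | _ = ≡.refl
... | suc k | p = contradiction (∣-trans (m∣m*n (2 ℕ.^ k)) p) 2∤n

-- Multiplied by `2 ^ suc v`, both odd parts become `2 * suc i`.
oddPart-dbl : ∀ i → oddPart (suc (dbl i)) ≡ oddPart (suc i)
oddPart-dbl i = ℕₚ.*-cancelˡ-≡ _ _ (2 ℕ.^ suc v) ⦃ ℕₚ.m^n≢0 2 (suc v) ⦄ (begin
  2 ℕ.^ suc v ℕ.* oddPart (suc (dbl i))                  ≡⟨ ≡.cong (λ k → 2 ℕ.^ k ℕ.* oddPart (suc (dbl i))) (v₂-dbl i) ⟨
  2 ℕ.^ v₂ (suc (dbl i)) ℕ.* oddPart (suc (dbl i))       ≡⟨ 2^v₂*oddPart≡n (suc (dbl i)) ⟩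
  2 ℕ.* suc i                                            ≡⟨ ≡.cong (2 ℕ.*_) (2^v₂*oddPart≡n (suc i)) ⟨
  2 ℕ.* (2 ℕ.^ v ℕ.* oddPart (suc i))                    ≡⟨ ℕₚ.*-assoc 2 (2 ℕ.^ v) _ ⟨
  2 ℕ.^ suc v ℕ.* oddPart (suc i)                        ∎)
  where
  open ≡.≡-Reasoning
  v = v₂ (suc i)

oddPart-v₂≡0 : ∀ n → v₂ n ≡ 0 → oddPart n ≡ n
oddPart-v₂≡0 n eq = ≡.trans (≡.sym (ℕₚ.*-identityˡ _))
  (≡.trans (≡.cong (λ k → 2 ℕ.^ k ℕ.* oddPart n) (≡.sym eq)) (2^v₂*oddPart≡n n))

-- Sums of squares of divisors.

divisorSquares : ℕ → ℕ → ℕ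
divisorSquares m zero    = 0
divisorSquares m (suc n) with suc n ∣? m
... | yes _ = divisorSquares m n ℕ.+ suc n ℕ.* suc n
... | no  _ = divisorSquares m n

-- For m = q * l, this says that ∑ 1 / q² over q ≥ d is at most 2 / d.
divisorSquares-tail : ∀ {m} n d → 0 ℕ.< m → (∀ {l} → l ℕ.≤ n → l ∣ m → d ℕ.* l ℕ.≤ m) →
                      d ℕ.* divisorSquares m n ℕ.≤ 2 ℕ.* (m ℕ.* m)
divisorSquares-tail {m} zero d _ _ = ≡.subst (ℕ._≤ 2 ℕ.* (m ℕ.* m)) (≡.sym (ℕₚ.*-zeroʳ d)) z≤n
divisorSquares-tail {m} (suc n) d 0<m small with suc n ∣? m
... | no  _ = divisorSquares-tail n d 0<m (small ∘ ℕₚ.m≤n⇒m≤1+n)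
... | yes (divides (suc p) ≡.refl) = ℕₚ.≤-trans (ℕₚ.*-monoˡ-≤ _ d≤q)
  -- This is 1 / q² + 2 / (q + 1) ≤ 2 / q with denominators cleared: `s` contributes m² / q², and
  -- the smaller divisors, whose cofactors exceed q, contribute at most 2m² / (q + 1) by induction.
  (ℕₚ.*-cancelˡ-≤ (suc q) (begin
    suc q ℕ.* (q ℕ.* (T ℕ.+ s ℕ.* s))                  ≡⟨ regroup q T s ⟩
    q ℕ.* (suc q ℕ.* T) ℕ.+ (m ℕ.* m ℕ.+ m ℕ.* s)      ≤⟨ ℕₚ.+-mono-≤ (ℕₚ.*-monoʳ-≤ q rest) (ℕₚ.+-monoʳ-≤ (m ℕ.* m) (ℕₚ.*-monoʳ-≤ m s≤m)) ⟩
    q ℕ.* (2 ℕ.* (m ℕ.* m)) ℕ.+ (m ℕ.* m ℕ.+ m ℕ.* m)  ≡⟨ collect q (m ℕ.* m) ⟩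
    suc q ℕ.* (2 ℕ.* (m ℕ.* m))                        ∎))
  where
  open ℕₚ.≤-Reasoning
  q = suc p
  s = suc n
  T = divisorSquares m n
  regroup : ∀ q T s → suc q ℕ.* (q ℕ.* (T ℕ.+ s ℕ.* s)) ≡
            q ℕ.* (suc q ℕ.* T) ℕ.+ ((q ℕ.* s) ℕ.* (q ℕ.* s) ℕ.+ (q ℕ.* s) ℕ.* s)
  regroup = solve-∀
  collect : ∀ q x → q ℕ.* (2 ℕ.* x) ℕ.+ (x ℕ.+ x) ≡ suc q ℕ.* (2 ℕ.* x)
  collect = solve-∀
  s≤m : s ℕ.≤ m
  s≤m = ℕₚ.m≤m+n s (p ℕ.* s)
  d≤q : d ℕ.≤ q
  d≤q = ℕₚ.*-cancelʳ-≤ d q s (small ℕₚ.≤-refl (divides q ≡.refl))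
  next : ∀ {l} → l ℕ.≤ n → l ∣ m → suc q ℕ.* l ℕ.≤ m
  next {l} l≤n (divides r eq) = begin
    suc q ℕ.* l ≤⟨ ℕₚ.*-monoˡ-≤ l q<r ⟩
    r ℕ.* l     ≡⟨ eq ⟨
    m           ∎
    where
    -- Were r ≤ q, then m = r * l would be at most q * n, which is less than q * s = m.
    q<r : q ℕ.< r
    q<r = ℕₚ.≰⇒> λ r≤q → ℕₚ.<⇒≱ (ℕₚ.*-monoʳ-< q (ℕₚ.n<1+n n)) (begin
      q ℕ.* s ≡⟨ eq ⟩
      r ℕ.* l ≤⟨ ℕₚ.*-mono-≤ r≤q l≤n ⟩
      q ℕ.* n ∎)
  rest : suc q ℕ.* T ℕ.≤ 2 ℕ.* (m ℕ.* m)
  rest = divisorSquares-tail n (suc q) 0<m next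

-- The tail estimate with d = 2, since a divisor below `suc j` has cofactor at least 2.
divisorSquares≤ : ∀ j → divisorSquares (suc j) j ℕ.≤ suc j ℕ.* suc j
divisorSquares≤ j = ℕₚ.*-cancelˡ-≤ 2 (divisorSquares-tail j 2 (s≤s z≤n) proper)
  where
  proper : ∀ {l} → l ℕ.≤ j → l ∣ suc j → 2 ℕ.* l ℕ.≤ suc j
  proper {l} l≤j (divides zero ())
  proper {l} l≤j (divides (suc zero) eq) =
    contradiction (ℕₚ.≤-reflexive (≡.trans eq (ℕₚ.*-identityˡ l))) (ℕₚ.<⇒≱ (s≤s l≤j))
  proper {l} l≤j (divides (suc (suc r)) eq) =
    ≡.subst (2 ℕ.* l ℕ.≤_) (≡.sym eq) (ℕₚ.*-monoˡ-≤ l (s≤s (s≤s (z≤n {r}))))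

-- Ring identities from the commutation relations.

module RingIdentities {c ℓ} (𝓡 : Ring c ℓ) where

  open Ring 𝓡
  open RingProperties 𝓡
  open SetoidReasoning setoid

  -- The hypothesis says that z * x squares to 1; conjugating by the involution x gives the same for
  -- x * z.
  conjugate-leftInverse : ∀ {x z} → x * x ≈ 1# → z * (x * z * x) ≈ 1# → x * z * x * z ≈ 1#
  conjugate-leftInverse {x} {z} x²≈1 zxzx≈1 = begin
    p * z               ≈⟨ *-congˡ (*-identityʳ z) ⟨
    p * (z * 1#)        ≈⟨ *-congˡ (*-congˡ x²≈1) ⟨
    p * (z * (x * x))   ≈⟨ *-congˡ (*-assoc z x x) ⟨
    p * (z * x * x)     ≈⟨ *-assoc p (z * x) x ⟨
    p * (z * x) * x     ≈⟨ *-congʳ inner ⟩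
    x * x               ≈⟨ x²≈1 ⟩
    1#                  ∎
    where
    p = x * z * x
    inner : p * (z * x) ≈ x
    inner = begin
      x * z * x * (z * x)     ≈⟨ *-congʳ (*-assoc x z x) ⟩
      x * (z * x) * (z * x)   ≈⟨ *-assoc x (z * x) (z * x) ⟩
      x * (z * x * (z * x))   ≈⟨ *-congˡ (*-assoc z x (z * x)) ⟩
      x * (z * (x * (z * x))) ≈⟨ *-congˡ (*-congˡ (*-assoc x z x)) ⟨
      x * (z * (x * z * x))   ≈⟨ *-congˡ zxzx≈1 ⟩
      x * 1#                  ≈⟨ *-identityʳ x ⟩
      x                       ∎

  leftInverse-unique : ∀ {z p w} → z * p ≈ 1# → w * z ≈ 1# → w ≈ p
  leftInverse-unique {z} {p} {w} zp≈1 wz≈1 = begin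
    w             ≈⟨ *-identityʳ w ⟨
    w * 1#        ≈⟨ *-congˡ zp≈1 ⟨
    w * (z * p)   ≈⟨ *-assoc w z p ⟨
    w * z * p     ≈⟨ *-congʳ wz≈1 ⟩
    1# * p        ≈⟨ *-identityˡ p ⟩
    p             ∎

  module Shift {s d x z : Carrier}
    (sd≈ds : s * d ≈ d * s) (sx≈-xs : s * x ≈ - (x * s)) (sz≈zn : s * z ≈ z * (d - 1#)) where

    private
      n y : Carrier
      n = d - 1#
      y = x * z

    sy≈-yn : s * y ≈ - (y * n)
    sy≈-yn = begin
      s * (x * z)      ≈⟨ *-assoc s x z ⟨
      s * x * z        ≈⟨ *-congʳ sx≈-xs ⟩
      - (x * s) * z    ≈⟨ -‿distribˡ-* (x * s) z ⟨
      - (x * s * z)    ≈⟨ -‿cong (*-assoc x s z) ⟩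
      - (x * (s * z))  ≈⟨ -‿cong (*-congˡ sz≈zn) ⟩
      - (x * (z * n))  ≈⟨ -‿cong (*-assoc x z n) ⟨
      - (y * n)        ∎

    -- Together with `sy[1-s]≈y[1-s][-n]`, this makes both sides of D Y = Y (I - S) solutions of S A
    -- = A (- N).
    sdy≈dy[-n] : s * (d * y) ≈ d * y * - n
    sdy≈dy[-n] = begin
      s * (d * y)      ≈⟨ *-assoc s d y ⟨
      s * d * y        ≈⟨ *-congʳ sd≈ds ⟩
      d * s * y        ≈⟨ *-assoc d s y ⟩
      d * (s * y)      ≈⟨ *-congˡ sy≈-yn ⟩
      d * - (y * n)    ≈⟨ *-congˡ (-‿distribʳ-* y n) ⟩
      d * (y * - n)    ≈⟨ *-assoc d y (- n) ⟨
      d * y * - n      ∎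

    d[1-s]≈[1-s]d : d * (1# - s) ≈ (1# - s) * d
    d[1-s]≈[1-s]d = begin
      d * (1# - s)       ≈⟨ x[y-z]≈xy-xz d 1# s ⟩
      d * 1# - d * s     ≈⟨ +-cong (trans (*-identityʳ d) (sym (*-identityˡ d))) (-‿cong (sym sd≈ds)) ⟩
      1# * d - s * d     ≈⟨ [y-z]x≈yx-zx d 1# s ⟨
      (1# - s) * d       ∎

    n[1-s]≈[1-s]n : n * (1# - s) ≈ (1# - s) * n
    n[1-s]≈[1-s]n = begin
      n * (1# - s)                        ≈⟨ [y-z]x≈yx-zx (1# - s) d 1# ⟩
      d * (1# - s) - 1# * (1# - s)        ≈⟨ +-cong d[1-s]≈[1-s]d (-‿cong (trans (*-identityˡ _) (sym (*-identityʳ _)))) ⟩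
      (1# - s) * d - (1# - s) * 1#        ≈⟨ x[y-z]≈xy-xz (1# - s) d 1# ⟨
      (1# - s) * n                        ∎

    sy[1-s]≈y[1-s][-n] : s * (y * (1# - s)) ≈ y * (1# - s) * - n
    sy[1-s]≈y[1-s][-n] = begin
      s * (y * (1# - s))        ≈⟨ *-assoc s y (1# - s) ⟨
      s * y * (1# - s)          ≈⟨ *-congʳ sy≈-yn ⟩
      - (y * n) * (1# - s)      ≈⟨ -‿distribˡ-* (y * n) (1# - s) ⟨
      - (y * n * (1# - s))      ≈⟨ -‿cong (*-assoc y n (1# - s)) ⟩
      - (y * (n * (1# - s)))    ≈⟨ -‿cong (*-congˡ n[1-s]≈[1-s]n) ⟩
      - (y * ((1# - s) * n))    ≈⟨ -‿cong (*-assoc y (1# - s) n) ⟨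
      - (y * (1# - s) * n)      ≈⟨ -‿distribʳ-* (y * (1# - s)) n ⟩
      y * (1# - s) * - n        ∎

    d≈1+n : d ≈ 1# + n
    d≈1+n = begin
      d                 ≈⟨ +-identityʳ d ⟨
      d + 0#            ≈⟨ +-congˡ (-‿inverseˡ 1#) ⟨
      d + (- 1# + 1#)   ≈⟨ +-assoc d (- 1#) 1# ⟨
      n + 1#            ≈⟨ +-comm n 1# ⟩
      1# + n            ∎

    -- As d = 1 + n, the relation `sy≈-yn` turns multiplication of y by d on the right into
    -- multiplication by 1 - s on the left.
    dyd≈d[1-s]y : d * y * d ≈ d * (1# - s) * y
    dyd≈d[1-s]y = begin
      d * y * d            ≈⟨ *-assoc d y d ⟩
      d * (y * d)          ≈⟨ *-congˡ yd≈[1-s]y ⟩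
      d * ((1# - s) * y)   ≈⟨ *-assoc d (1# - s) y ⟨
      d * (1# - s) * y     ∎
      where
      yd≈[1-s]y : y * d ≈ (1# - s) * y
      yd≈[1-s]y = begin
        y * d             ≈⟨ *-congˡ d≈1+n ⟩
        y * (1# + n)      ≈⟨ distribˡ y 1# n ⟩
        y * 1# + y * n    ≈⟨ +-cong (trans (*-identityʳ y) (sym (*-identityˡ y)))
                               (trans (sym (-‿involutive (y * n))) (-‿cong (sym sy≈-yn))) ⟩
        1# * y - s * y    ≈⟨ [y-z]x≈yx-zx y 1# s ⟨
        (1# - s) * y      ∎

    -- For the matrices this hypothesis is `DY≋Y[I-S]`, which is proved by comparing rows.
    module _ (dy≈y[1-s] : d * y ≈ y * (1# - s)) where

      ny≈-ys : n * y ≈ - (y * s)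
      ny≈-ys = begin
        n * y                        ≈⟨ [y-z]x≈yx-zx y d 1# ⟩
        d * y - 1# * y               ≈⟨ +-cong dy≈y[1-s] (-‿cong (*-identityˡ y)) ⟩
        y * (1# - s) - y             ≈⟨ +-congʳ (x[y-z]≈xy-xz y 1# s) ⟩
        y * 1# - y * s - y           ≈⟨ +-congʳ (+-congʳ (*-identityʳ y)) ⟩
        y - y * s - y                ≈⟨ xyx⁻¹≈y y (- (y * s)) ⟩
        - (y * s)                    ∎

      -- In the application y * x is `P`. The sign from `ny≈-ys` cancels against the one from moving
      -- s past x.
      nyx≈yxs : n * (y * x) ≈ y * x * s
      nyx≈yxs = begin
        n * (y * x)        ≈⟨ *-assoc n y x ⟨
        n * y * x          ≈⟨ *-congʳ ny≈-ys ⟩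
        - (y * s) * x      ≈⟨ -‿distribˡ-* (y * s) x ⟨
        - (y * s * x)      ≈⟨ -‿cong (*-assoc y s x) ⟩
        - (y * (s * x))    ≈⟨ -‿cong (*-congˡ sx≈-xs) ⟩
        - (y * - (x * s))  ≈⟨ -‿distribʳ-* y (- (x * s)) ⟩
        y * - - (x * s)    ≈⟨ *-congˡ (-‿involutive (x * s)) ⟩
        y * (x * s)        ≈⟨ *-assoc y x s ⟨
        y * x * s          ∎

      szyx≈zyxs : s * (z * (y * x)) ≈ z * (y * x) * s
      szyx≈zyxs = begin
        s * (z * (y * x))   ≈⟨ *-assoc s z (y * x) ⟨
        s * z * (y * x)     ≈⟨ *-congʳ sz≈zn ⟩
        z * n * (y * x)     ≈⟨ *-assoc z n (y * x) ⟩
        z * (n * (y * x))   ≈⟨ *-congˡ nyx≈yxs ⟩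
        z * (y * x * s)     ≈⟨ *-assoc z (y * x) s ⟨
        z * (y * x) * s     ∎

-- The ring of column-finite matrices.

module MatrixRing {c ℓ} (K : CommutativeRing c ℓ) where

  open CommutativeRing K
  open Matrices K
  open SemiringSum semiring
    using (sum; sum-cong-≋; sum-init-last; ∑-comm; *-distribˡ-sum; *-distribʳ-sum; ∑-distrib-+)
  open RingProperties ring using (-0#≈0#)
  open SetoidReasoning setoid

  -- The summand lives on all of ℕ, so the range can vary while the summand stays the same.
  sum< : ℕ → (ℕ → Carrier) → Carrier
  sum< n f = sum {n} (f ∘ toℕ)

  sum<-last : ∀ n f → sum< (suc n) f ≈ sum< n f + f n
  sum<-last n f = trans (sum-init-last {n} (f ∘ toℕ))
    (+-cong (sum-cong-≋ {n} λ k → reflexive (≡.cong f (toℕ-inject₁ k)))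
            (reflexive (≡.cong f (toℕ-fromℕ n))))

  sum<-extend : ∀ {m n} f → m ℕ.≤ n → (∀ {k} → m ℕ.≤ k → f k ≈ 0#) → sum< m f ≈ sum< n f
  sum<-extend {n = n} f z≤n       f≈0 = sym (sum-zero n λ _ → f≈0 z≤n)
  sum<-extend         f (s≤s m≤n) f≈0 = +-congˡ (sum<-extend (f ∘ suc) m≤n (f≈0 ∘ s≤s))

  sum<-single : ∀ {n p} f → p ℕ.< n → (∀ k → k ≢ p → f k ≈ 0#) → sum< n f ≈ f p
  sum<-single {suc n} {p} f (s≤s p≤n) f≈0 = begin
    sum< (suc n) f   ≈⟨ sum<-extend f (s≤s p≤n) (λ p<k → f≈0 _ (ℕₚ.<⇒≢ p<k ∘ ≡.sym)) ⟨
    sum< (suc p) f   ≈⟨ sum<-last p f ⟩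
    sum< p f + f p   ≈⟨ +-congʳ (sum-zero p λ k → f≈0 _ (ℕₚ.<⇒≢ (toℕ<n k))) ⟩
    0# + f p         ≈⟨ +-identityˡ _ ⟩
    f p              ∎

  -- A product sums up to the bound chosen for its right factor; passing to any larger range makes
  -- products with different bounds comparable.
  ⊗-entry : ∀ A B {i j n} → bound B j ℕ.≤ n →
            entry (A ⊗ B) i j ≈ sum< n λ k → entry A i k * entry B k j
  ⊗-entry A B {i} {j} b≤n = sum<-extend (λ k → entry A i k * entry B k j) b≤n λ b≤k → trans (*-congˡ (vanish B b≤k)) (zeroʳ _)

  ⊗-cong-terms : ∀ A B A′ B′ {i j i′ j′} →
    (∀ k → entry A i k * entry B k j ≈ entry A′ i′ k * entry B′ k j′) →
    entry (A ⊗ B) i j ≈ entry (A′ ⊗ B′) i′ j′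
  ⊗-cong-terms A B A′ B′ {i} {j} {i′} {j′} eq = begin
    entry (A ⊗ B) i j                              ≈⟨ ⊗-entry A B (ℕₚ.m≤m⊔n _ _) ⟩
    (sum< n λ k → entry A i k * entry B k j)       ≈⟨ sum-cong-≋ {n} (eq ∘ toℕ) ⟩
    (sum< n λ k → entry A′ i′ k * entry B′ k j′)   ≈⟨ ⊗-entry A′ B′ (ℕₚ.m≤n⊔m (bound B j) _) ⟨
    entry (A′ ⊗ B′) i′ j′                          ∎
    where n = bound B j ℕ.⊔ bound B′ j′

  ⊗-congRow : ∀ A A′ B {i i′} j → (∀ k → entry A i k ≈ entry A′ i′ k) →
              entry (A ⊗ B) i j ≈ entry (A′ ⊗ B) i′ j
  ⊗-congRow A A′ B j eq = ⊗-cong-terms A B A′ B λ k → *-congʳ (eq k)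

  ⊗-single : ∀ A B {i j} p → (∀ k → k ≢ p → entry A i k * entry B k j ≈ 0#) →
             entry (A ⊗ B) i j ≈ entry A i p * entry B p j
  ⊗-single A B {i} {j} p zeros =
    trans (⊗-entry A B (ℕₚ.m≤m⊔n (bound B j) (suc p))) (sum<-single (λ k → entry A i k * entry B k j) (ℕₚ.m≤n⊔m (bound B j) (suc p)) zeros)

  ⊗-cong : ∀ {A A′ B B′} → A ≋ A′ → B ≋ B′ → A ⊗ B ≋ A′ ⊗ B′
  ⊗-cong {A} {A′} {B} {B′} A≋ B≋ i j = ⊗-cong-terms A B A′ B′ λ k → *-cong (A≋ i k) (B≋ k j)

  ⊗-assoc : ∀ A B C → (A ⊗ B) ⊗ C ≋ A ⊗ (B ⊗ C)
  ⊗-assoc A B C i j = begin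
    (sum< n λ k → entry (A ⊗ B) i k * entry C k j)
      -- `m` bounds every column of `B` that occurs, so the inner range no longer depends on `k` and
      -- the two sums can be exchanged.
      ≈⟨ sum-cong-≋ {n} (λ k → trans (*-congʳ (⊗-entry A B (f≤maxUpTo (bound B) (toℕ<n k))))
           (*-distribʳ-sum {m} _ _)) ⟩
    (sum< n λ k → sum< m λ l → (entry A i l * entry B l k) * entry C k j)
      ≈⟨ ∑-comm {n} {m} _ ⟩
    (sum< m λ l → sum< n λ k → (entry A i l * entry B l k) * entry C k j)
      ≈⟨ sum-cong-≋ {m} (λ _ → trans (sum-cong-≋ {n} λ _ → *-assoc _ _ _) (sym (*-distribˡ-sum {n} _ _))) ⟩
    (sum< m λ l → entry A i l * entry (B ⊗ C) l j)
      ∎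
    where
    n = bound C j
    m = maxUpTo (bound B) n

  when-yes : ∀ {p} {P : Set p} (P? : Dec P) {x} → P → (x when P?) ≈ x
  when-yes (yes _) _ = refl
  when-yes (no ¬p) p = contradiction p ¬p

  when-no : ∀ {p} {P : Set p} (P? : Dec P) {x} → ¬ P → (x when P?) ≈ 0#
  when-no (yes p) ¬p = contradiction p ¬p
  when-no (no _)  _  = refl

  when-⇔ : ∀ {p q} {P : Set p} {Q : Set q} (P? : Dec P) (Q? : Dec Q) {x} →
           (P → Q) → (Q → P) → (x when P?) ≈ (x when Q?)
  when-⇔ (yes p) Q? to from = sym (when-yes Q? (to p))
  when-⇔ (no ¬p) Q? to from = sym (when-no Q? (¬p ∘ from))

  diagonal-⊗ : ∀ f A i j → entry (diagonal f ⊗ A) i j ≈ f i * entry A i j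
  diagonal-⊗ f A i j = trans
    (⊗-single (diagonal f) A {i} i λ k k≢i → trans (*-congʳ (when-no (i ℕₚ.≟ k) (k≢i ∘ ≡.sym))) (zeroˡ _))
    (*-congʳ (when-yes (i ℕₚ.≟ i) ≡.refl))

  ⊗-diagonal : ∀ A f i j → entry (A ⊗ diagonal f) i j ≈ entry A i j * f j
  ⊗-diagonal A f i j = trans
    (⊗-single A (diagonal f) j λ k k≢j → trans (*-congˡ (when-no (k ℕₚ.≟ j) k≢j)) (zeroʳ _))
    (*-congˡ (when-yes (j ℕₚ.≟ j) ≡.refl))

  infixl 6 _⊕_
  _⊕_ : Matrix → Matrix → Matrix
  entry  (A ⊕ B) i j = entry A i j + entry B i j
  bound  (A ⊕ B) j   = bound A j ℕ.⊔ bound B j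
  vanish (A ⊕ B) {i} {j} b≤i = trans
    (+-cong (vanish A (ℕₚ.≤-trans (ℕₚ.m≤m⊔n _ _) b≤i))
            (vanish B (ℕₚ.≤-trans (ℕₚ.m≤n⊔m (bound A j) _) b≤i)))
    (+-identityʳ 0#)

  ⊝_ : Matrix → Matrix
  entry  (⊝ A) i j = - entry A i j
  bound  (⊝ A) j   = bound A j
  vanish (⊝ A) b≤i = trans (-‿cong (vanish A b≤i)) -0#≈0#

  O : Matrix
  entry  O i j = 0#
  bound  O j   = 0
  vanish O _   = refl

  ⊗-distribˡ : ∀ A B C → A ⊗ (B ⊕ C) ≋ A ⊗ B ⊕ A ⊗ C
  ⊗-distribˡ A B C i j = begin
    (sum< n λ k → entry A i k * (entry B k j + entry C k j))
      ≈⟨ sum-cong-≋ {n} (λ _ → distribˡ _ _ _) ⟩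
    (sum< n λ k → entry A i k * entry B k j + entry A i k * entry C k j)
      ≈⟨ ∑-distrib-+ {n} _ _ ⟩
    (sum< n λ k → entry A i k * entry B k j) + (sum< n λ k → entry A i k * entry C k j)
      ≈⟨ +-cong (⊗-entry A B (ℕₚ.m≤m⊔n _ _)) (⊗-entry A C (ℕₚ.m≤n⊔m (bound B j) _)) ⟨
    entry (A ⊗ B) i j + entry (A ⊗ C) i j
      ∎
    where n = bound B j ℕ.⊔ bound C j

  ⊗-distribʳ : ∀ A B C → (B ⊕ C) ⊗ A ≋ B ⊗ A ⊕ C ⊗ A
  ⊗-distribʳ A B C i j =
    trans (sum-cong-≋ {bound A j} λ _ → distribʳ _ _ _) (∑-distrib-+ {bound A j} _ _)

  matrixRing : Ring (c ⊔ ℓ) ℓ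
  matrixRing = record
    { Carrier = Matrix
    ; _≈_     = _≋_
    ; _+_     = _⊕_
    ; _*_     = _⊗_
    ; -_      = ⊝_
    ; 0#      = O
    ; 1#      = I
    ; isRing  = record
      { +-isAbelianGroup = record
        { isGroup = record
          { isMonoid = record
            { isSemigroup = record
              { isMagma = record
                { isEquivalence = record
                  { refl  = λ _ _ → refl
                  ; sym   = λ p i j → sym (p i j)
                  ; trans = λ p q i j → trans (p i j) (q i j)
                  }
                ; ∙-cong = λ p q i j → +-cong (p i j) (q i j)
                }
              ; assoc = λ _ _ _ _ _ → +-assoc _ _ _
              }
            ; identity = (λ _ _ _ → +-identityˡ _) , λ _ _ _ → +-identityʳ _
            }
          ; inverse = (λ _ _ _ → -‿inverseˡ _) , λ _ _ _ → -‿inverseʳ _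
          ; ⁻¹-cong = λ p i j → -‿cong (p i j)
          }
        ; comm = λ _ _ _ _ → +-comm _ _
        }
      ; *-cong     = λ {A} {A′} {B} {B′} → ⊗-cong {A} {A′} {B} {B′}
      ; *-assoc    = ⊗-assoc
      ; *-identity = (λ A i j → trans (diagonal-⊗ (λ _ → 1#) A i j) (*-identityˡ _))
                   , (λ A i j → trans (⊗-diagonal A (λ _ → 1#) i j) (*-identityʳ _))
      ; distrib    = ⊗-distribˡ , ⊗-distribʳ
      }
    }

-- The doubling shift and the divisor matrix.

module DivisorMatrix {c ℓ} (K : CommutativeRing c ℓ) where

  open CommutativeRing K
  open Matrices K
  open MatrixRing K
  open SemiringExp semiring using (_^_; ^-homo-*)
  open SemiringSum semiring using (sum-cong-≋)
  open SemiringMult semiring using (×-homo-+) renaming (_×_ to _·_)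
  open RingProperties ring using (-‿distribˡ-*; -1*x≈-x; +-cancelˡ; -‿involutive; -0#≈0#)
  open SetoidReasoning setoid

  S : Matrix
  entry  S i j = 1# when (dbl i ℕₚ.≟ j)
  bound  S j   = j
  vanish S {i} {j} j≤i =
    when-no (dbl i ℕₚ.≟ j) λ 2i≡j → ℕₚ.<⇒≱ (i<dbl i) (≡.subst (ℕ._≤ i) (≡.sym 2i≡j) j≤i)

  S-⊗ : ∀ A i j → entry (S ⊗ A) i j ≈ entry A (dbl i) j
  S-⊗ A i j = begin
    entry (S ⊗ A) i j
      ≈⟨ ⊗-single S A {i} {j} (dbl i) (λ k k≢2i → trans (*-congʳ (when-no (dbl i ℕₚ.≟ k) (k≢2i ∘ ≡.sym))) (zeroˡ _)) ⟩
    entry S i (dbl i) * entry A (dbl i) j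
      ≈⟨ *-congʳ (when-yes (dbl i ℕₚ.≟ dbl i) ≡.refl) ⟩
    1# * entry A (dbl i) j
      ≈⟨ *-identityˡ _ ⟩
    entry A (dbl i) j
      ∎

  ⊗-S-even : ∀ A i m → entry (A ⊗ S) i (dbl m) ≈ entry A i m
  ⊗-S-even A i m = begin
    entry (A ⊗ S) i (dbl m)
      ≈⟨ ⊗-single A S {i} {dbl m} m (λ k k≢m → trans (*-congˡ (when-no (dbl k ℕₚ.≟ dbl m) (k≢m ∘ dbl-injective))) (zeroʳ _)) ⟩
    entry A i m * entry S m (dbl m)
      ≈⟨ *-congˡ (when-yes (dbl m ℕₚ.≟ dbl m) ≡.refl) ⟩
    entry A i m * 1#
      ≈⟨ *-identityʳ _ ⟩
    entry A i m
      ∎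

  ⊗-S-odd : ∀ A i {j} → ¬ 2 ∣ suc j → entry (A ⊗ S) i j ≈ 0#
  ⊗-S-odd A i {j} 2∤j = sum-zero (bound S j) λ k → trans
    (*-congˡ (when-no (dbl (toℕ k) ℕₚ.≟ j) λ 2k≡j → 2∤j (≡.subst (λ n → 2 ∣ suc n) 2k≡j (2∣suc-dbl (toℕ k)))))
    (zeroʳ _)

  -- Row `dbl m` of A is row m of S A = A T, so it depends only on row m of A. Strong induction on
  -- the row index thus descends to the odd rows.
  S-intertwiner-unique : ∀ {A B} T → S ⊗ A ≋ A ⊗ T → S ⊗ B ≋ B ⊗ T →
    (∀ {i} → ¬ 2 ∣ suc i → ∀ j → entry A i j ≈ entry B i j) → A ≋ B
  S-intertwiner-unique {A} {B} T SA≋AT SB≋BT odd-rows = <-rec _ row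
    where
    row : ∀ i → (∀ {k} → k ℕ.< i → ∀ j → entry A k j ≈ entry B k j) →
          ∀ j → entry A i j ≈ entry B i j
    row i rec j with parity i
    ... | odd 2∤i = odd-rows 2∤i j
    ... | even m  = begin
      entry A (dbl m) j   ≈⟨ S-⊗ A m j ⟨
      entry (S ⊗ A) m j   ≈⟨ SA≋AT m j ⟩
      entry (A ⊗ T) m j   ≈⟨ ⊗-congRow A B T j (rec (i<dbl m)) ⟩
      entry (B ⊗ T) m j   ≈⟨ SB≋BT m j ⟨
      entry (S ⊗ B) m j   ≈⟨ S-⊗ B m j ⟩
      entry B (dbl m) j   ∎

  -- In an even column this says that 2a ∣ 2b if and only if a ∣ b; in an odd column both sides
  -- vanish.
  SD≋DS : S ⊗ D ≋ D ⊗ S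
  SD≋DS i j = trans (S-⊗ D i j) (column (parity j))
    where
    column : ∀ {j} → Parity j → entry D (dbl i) j ≈ entry (D ⊗ S) i j
    column {j} (odd 2∤j) = trans
      (when-no (suc (dbl i) ∣? suc j) (2∤j ∘ ∣-trans (2∣suc-dbl i)))
      (sym (⊗-S-odd D i 2∤j))
    column (even m) = trans
      (when-⇔ (suc (dbl i) ∣? suc (dbl m)) (suc i ∣? suc m) (*-cancelˡ-∣ 2) (*-monoʳ-∣ 2))
      (sym (⊗-S-even D i m))

  -- D is upper unitriangular, so a row of A is recovered from the same row of A D column by column:
  -- the last term of the sum is the wanted entry, and the others are known by induction.
  D-cancelʳ-row : ∀ A B {i} → (∀ j → entry (A ⊗ D) i j ≈ entry (B ⊗ D) i j) →
                  ∀ j → entry A i j ≈ entry B i j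
  D-cancelʳ-row A B {i} AD≈BD = <-rec _ λ j rec →
    let step : ∀ C → entry (C ⊗ D) i j ≈ (sum< j λ k → entry C i k * entry D k j) + entry C i j
        step C = trans (sum<-last j λ k → entry C i k * entry D k j)
          (+-congˡ (trans (*-congˡ (when-yes (suc j ∣? suc j) ∣-refl)) (*-identityʳ _)))
    in +-cancelˡ _ _ _ (begin
      (sum< j λ k → entry A i k * entry D k j) + entry A i j  ≈⟨ step A ⟨
      entry (A ⊗ D) i j                                       ≈⟨ AD≈BD j ⟩
      entry (B ⊗ D) i j                                       ≈⟨ step B ⟩
      (sum< j λ k → entry B i k * entry D k j) + entry B i j
        ≈⟨ +-congʳ (sum-cong-≋ {j} λ k → *-congʳ (rec (toℕ<n k))) ⟨
      (sum< j λ k → entry A i k * entry D k j) + entry B i j  ∎)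

  -- The sign matrix.

  sign : ℕ → Carrier
  sign i = (- 1#) ^ v₂ (suc i)

  sign-dbl : ∀ i → sign (dbl i) ≈ - sign i
  sign-dbl i = trans (reflexive (≡.cong ((- 1#) ^_) (v₂-dbl i))) (-1*x≈-x (sign i))

  sign-odd : ∀ {i} → ¬ 2 ∣ suc i → sign i ≈ 1#
  sign-odd 2∤i = reflexive (≡.cong ((- 1#) ^_) (v₂-odd 2∤i))

  [-1]^n≈±1 : ∀ n → (- 1#) ^ n ≈ 1# ⊎ (- 1#) ^ n ≈ - 1#
  [-1]^n≈±1 zero    = inj₁ refl
  [-1]^n≈±1 (suc n) with [-1]^n≈±1 n
  ... | inj₁ eq = inj₂ (trans (*-congˡ eq) (*-identityʳ _))
  ... | inj₂ eq = inj₁ (trans (*-congˡ eq) (trans (-1*x≈-x _) (-‿involutive 1#)))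

  sign² : ∀ i → sign i * sign i ≈ 1#
  sign² i with [-1]^n≈±1 (v₂ (suc i))
  ... | inj₁ eq = trans (*-cong eq eq) (*-identityˡ 1#)
  ... | inj₂ eq = trans (*-cong eq eq) (trans (-1*x≈-x _) (-‿involutive 1#))

  XX≋I : X ⊗ X ≋ I
  XX≋I i j = trans (diagonal-⊗ sign X i j) (square i j)
    where
    square : ∀ i j → sign i * entry X i j ≈ entry I i j
    square i j with i ℕₚ.≟ j
    ... | yes _ = sign² i
    ... | no  _ = zeroʳ _

  -- Doubling the row index raises `v₂` by one and so flips the sign.
  SX≋-XS : S ⊗ X ≋ ⊝ (X ⊗ S)
  SX≋-XS i j = trans (S-⊗ X i j) (trans (double i j) (-‿cong (sym (diagonal-⊗ sign S i j))))
    where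
    double : ∀ i j → entry X (dbl i) j ≈ - (sign i * entry S i j)
    double i j with dbl i ℕₚ.≟ j
    ... | yes _ = trans (sign-dbl i) (-‿cong (sym (*-identityʳ _)))
    ... | no  _ = sym (trans (-‿distribˡ-* _ _) (zeroʳ _))

  -- The rows of Z.

  Z-odd : ∀ {i} → ¬ 2 ∣ suc i → ∀ j → entry Z i j ≈ entry I i j
  Z-odd {i} 2∤i j = reflexive (≡.cong (λ k → Z-row k i j) (v₂-odd 2∤i))

  -- The separate clause of `Z-row` for exponent 0 fits the general formula: the zeroth power is
  -- `I`, and an odd number is its own odd part.
  Z-power : ∀ i j → entry Z i j ≈ entry (D-I ⊗^ v₂ (suc i)) (pred (oddPart (suc i))) j
  Z-power i j = row (v₂ (suc i)) ≡.refl
    where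
    row : ∀ k → v₂ (suc i) ≡ k → Z-row k i j ≈ entry (D-I ⊗^ k) (pred (oddPart (suc i))) j
    row zero    eq = reflexive (≡.cong (λ d → entry I (pred d) j) (≡.sym (oddPart-v₂≡0 (suc i) eq)))
    row (suc k) _  = refl

  -- Doubling the row index keeps the odd part and adds one to the exponent, which is one more
  -- factor `D-I` on the right.
  SZ≋ZN : S ⊗ Z ≋ Z ⊗ D-I
  SZ≋ZN i j = begin
    entry (S ⊗ Z) i j
      ≈⟨ S-⊗ Z i j ⟩
    Z-row (v₂ (suc (dbl i))) (dbl i) j
      ≡⟨ ≡.cong (λ k → Z-row k (dbl i) j) (v₂-dbl i) ⟩
    entry (D-I ⊗^ suc v) (pred (oddPart (suc (dbl i)))) j
      ≡⟨ ≡.cong (λ d → entry (D-I ⊗^ suc v) (pred d) j) (oddPart-dbl i) ⟩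
    entry (D-I ⊗^ v ⊗ D-I) (pred (oddPart (suc i))) j
      ≈⟨ ⊗-congRow Z (D-I ⊗^ v) D-I {i} j (Z-power i) ⟨
    entry (Z ⊗ D-I) i j
      ∎
    where v = v₂ (suc i)

  open RingIdentities matrixRing
  open Shift {S} {D} {X} {Z} SD≋DS SX≋-XS SZ≋ZN
  private module M = Ring matrixRing

  -- The identity D Y = Y (I - S).

  Y : Matrix
  Y = X ⊗ Z

  I-S : Matrix
  I-S = I ⊕ ⊝ S

  Y-odd : ∀ {i} → ¬ 2 ∣ suc i → ∀ j → entry Y i j ≈ entry I i j
  Y-odd {i} 2∤i j = begin
    entry Y i j             ≈⟨ diagonal-⊗ sign Z i j ⟩
    sign i * entry Z i j    ≈⟨ *-cong (sign-odd 2∤i) (Z-odd 2∤i j) ⟩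
    1# * entry I i j        ≈⟨ *-identityˡ _ ⟩
    entry I i j             ∎

  -- An odd number divides 2b exactly when it divides b, so columns 2b of D and of D S agree in an
  -- odd row.
  D[I-S]-odd-even : ∀ {i} → ¬ 2 ∣ suc i → ∀ m → entry (D ⊗ I-S) i (dbl m) ≈ 0#
  D[I-S]-odd-even {i} 2∤i m = begin
    entry (D ⊗ I-S) i (dbl m)
      ≈⟨ ⊗-distribˡ D I (⊝ S) i (dbl m) ⟩
    entry (D ⊗ I) i (dbl m) + entry (D ⊗ ⊝ S) i (dbl m)
      ≈⟨ +-cong (M.*-identityʳ D i (dbl m)) (sym (MP.-‿distribʳ-* D S i (dbl m))) ⟩
    entry D i (dbl m) - entry (D ⊗ S) i (dbl m)
      ≈⟨ +-cong (when-⇔ (suc i ∣? suc (dbl m)) (suc i ∣? suc m) (odd-∣-double (suc m) 2∤i) (∣n⇒∣m*n 2))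
           (-‿cong (⊗-S-even D i m)) ⟩
    entry D i m - entry D i m
      ≈⟨ -‿inverseʳ _ ⟩
    0#
      ∎
    where module MP = RingProperties matrixRing

  DY-odd : ∀ {i} → ¬ 2 ∣ suc i → ∀ j → entry (D ⊗ Y) i j ≈ entry (Y ⊗ I-S) i j
  DY-odd {i} 2∤i = D-cancelʳ-row (D ⊗ Y) (Y ⊗ I-S) {i} λ j → begin
    entry (D ⊗ Y ⊗ D) i j      ≈⟨ dyd≈d[1-s]y i j ⟩
    -- Row k of Y may be replaced by that of I: they agree for odd positions, and at even ones the
    -- coefficient from D (I - S) is zero.
    entry (D ⊗ I-S ⊗ Y) i j    ≈⟨ ⊗-cong-terms (D ⊗ I-S) Y (D ⊗ I-S) I {i} {j} {i} {j} (λ k → term k j (parity k)) ⟩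
    entry (D ⊗ I-S ⊗ I) i j    ≈⟨ M.*-identityʳ (D ⊗ I-S) i j ⟩
    entry (D ⊗ I-S) i j        ≈⟨ d[1-s]≈[1-s]d i j ⟩
    entry (I-S ⊗ D) i j        ≈⟨ ⊗-congRow (Y ⊗ I-S) I-S D {i} {i} j (λ k →
                                    trans (⊗-congRow Y I I-S {i} {i} k (Y-odd 2∤i)) (M.*-identityˡ I-S i k)) ⟨
    entry (Y ⊗ I-S ⊗ D) i j    ∎
    where
    term : ∀ k j → Parity k →
           entry (D ⊗ I-S) i k * entry Y k j ≈ entry (D ⊗ I-S) i k * entry I k j
    term k j (odd 2∤k) = *-congˡ (Y-odd 2∤k j)
    term _ j (even m)  = trans (trans (*-congʳ zero-entry) (zeroˡ _))
                               (sym (trans (*-congʳ zero-entry) (zeroˡ _)))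
      where zero-entry = D[I-S]-odd-even 2∤i m

  DY≋Y[I-S] : D ⊗ Y ≋ Y ⊗ I-S
  -- The last argument is - N, spelled in the ring operations in which `Shift` yields it.
  DY≋Y[I-S] = S-intertwiner-unique {D ⊗ Y} {Y ⊗ I-S} (⊝ (D ⊕ ⊝ I))
    sdy≈dy[-n] sy[1-s]≈y[1-s][-n] DY-odd

  -- The inverse of Z.

  P : Matrix
  P = X ⊗ Z ⊗ X

  -- In an odd row Z, Y and X all agree with I, so the row passes from Z P to P = Y X, then to X X =
  -- I.
  ZP-odd : ∀ {i} → ¬ 2 ∣ suc i → ∀ j → entry (Z ⊗ P) i j ≈ entry I i j
  ZP-odd {i} 2∤i j = begin
    entry (Z ⊗ P) i j      ≈⟨ ⊗-congRow Z I P {i} {i} j (Z-odd 2∤i) ⟩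
    entry (I ⊗ P) i j      ≈⟨ M.*-identityˡ P i j ⟩
    entry (Y ⊗ X) i j      ≈⟨ ⊗-congRow Y X X {i} {i} j (λ k → trans (Y-odd 2∤i k) (sym (X-odd k))) ⟩
    entry (X ⊗ X) i j      ≈⟨ XX≋I i j ⟩
    entry I i j            ∎
    where
    X-odd : ∀ k → entry X i k ≈ entry I i k
    X-odd k with i ℕₚ.≟ k
    ... | yes _ = sign-odd 2∤i
    ... | no  _ = refl

  ZP≋I : Z ⊗ P ≋ I
  ZP≋I = S-intertwiner-unique {Z ⊗ P} {I} S (szyx≈zyxs DY≋Y[I-S])
    (λ i j → trans (M.*-identityʳ S i j) (sym (M.*-identityˡ S i j))) ZP-odd

  P-inverse : IsInverse Z P
  P-inverse = ZP≋I , conjugate-leftInverse {X} {Z} XX≋I ZP≋I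

  inverse≋P : ∀ W → IsInverse Z W → W ≋ P
  inverse≋P W (_ , WZ≋I) = leftInverse-unique {Z} {P} {W} ZP≋I WZ≋I

  -- Size of the entries.

  infix 4 _≤ₙ_
  -- K carries no order, so an entry is bounded through a natural number that represents it.
  _≤ₙ_ : Carrier → ℕ → Set ℓ
  x ≤ₙ b = ∃[ n ] n ℕ.≤ b × x ≈ n · 1#

  ≤ₙ-resp : ∀ {x y b} → x ≈ y → x ≤ₙ b → y ≤ₙ b
  ≤ₙ-resp x≈y (n , n≤b , x≈n) = n , n≤b , trans (sym x≈y) x≈n

  ≤ₙ-weaken : ∀ {x b b′} → b ℕ.≤ b′ → x ≤ₙ b → x ≤ₙ b′
  ≤ₙ-weaken b≤b′ (n , n≤b , x≈n) = n , ℕₚ.≤-trans n≤b b≤b′ , x≈n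

  0≤ₙ : ∀ {x b} → x ≈ 0# → x ≤ₙ b
  0≤ₙ x≈0 = 0 , z≤n , x≈0

  1≤ₙ : ∀ {x b} → x ≈ 1# → x ≤ₙ suc b
  1≤ₙ x≈1 = 1 , s≤s z≤n , trans x≈1 (sym (+-identityʳ 1#))

  +-≤ₙ : ∀ {x y b b′} → x ≤ₙ b → y ≤ₙ b′ → x + y ≤ₙ b ℕ.+ b′
  +-≤ₙ (m , m≤b , x≈m) (n , n≤b′ , y≈n) =
    m ℕ.+ n , ℕₚ.+-mono-≤ m≤b n≤b′ , trans (+-cong x≈m y≈n) (sym (×-homo-+ 1# m n))

  sum<-divisorSquares : ∀ m n f →
    (∀ k → f k ≈ 0# ⊎ suc k ∣ m × f k ≤ₙ suc k ℕ.* suc k) → sum< n f ≤ₙ divisorSquares m n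
  sum<-divisorSquares m zero    f _     = 0≤ₙ refl
  sum<-divisorSquares m (suc n) f terms
    with suc n ∣? m | sum<-divisorSquares m n f terms | terms n
  ... | yes _  | rest | inj₁ fn≈0       = ≤ₙ-resp (sym (sum<-last n f)) (+-≤ₙ rest (0≤ₙ fn≈0))
  ... | yes _  | rest | inj₂ (_ , fn≤)  = ≤ₙ-resp (sym (sum<-last n f)) (+-≤ₙ rest fn≤)
  ... | no  _  | rest | inj₁ fn≈0       =
    ≤ₙ-resp (sym (trans (sum<-last n f) (trans (+-congˡ fn≈0) (+-identityʳ _)))) rest
  ... | no n∤m | _    | inj₂ (n∣m , _)  = contradiction n∣m n∤m

  D-I-entry : ∀ k j → entry D-I k j ≈ 0# ⊎ suc k ∣ suc j × entry D-I k j ≈ 1#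
  D-I-entry k j with k ℕₚ.≟ j | suc k ∣? suc j
  ... | yes _      | yes _   = inj₁ (-‿inverseʳ 1#)
  ... | yes ≡.refl | no  k∤k = contradiction ∣-refl k∤k
  ... | no  _      | yes k∣j = inj₂ (k∣j , trans (+-congˡ -0#≈0#) (+-identityʳ 1#))
  ... | no  _      | no  _   = inj₁ (-‿inverseʳ 0#)

  -- The bound does not depend on k: a further factor `D-I` adds up the entries in the columns l
  -- properly dividing j, each at most l², and these squares sum to at most j².
  D-I-power-≤ₙ : ∀ k i j → entry (D-I ⊗^ k) i j ≤ₙ suc j ℕ.* suc j
  D-I-power-≤ₙ zero i j with i ℕₚ.≟ j
  ... | yes _ = 1≤ₙ refl
  ... | no  _ = 0≤ₙ refl
  D-I-power-≤ₙ (suc k) i j = ≤ₙ-resp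
    -- The product ranges over the shifted indices up to and including `j`; stopping before `j`
    -- drops the vanishing diagonal term, so that only proper divisors remain.
    (sum<-extend term (ℕₚ.≤-trans (ℕₚ.n≤1+n j) (ℕₚ.m≤m⊔n (suc j) (suc j))) λ {l} j≤l →
      trans (*-congˡ (D-I-vanish l j (ℕₚ.≤-<-trans (s≤s j≤l) (s≤s (i<dbl l))))) (zeroʳ _))
    (≤ₙ-weaken (divisorSquares≤ j) (sum<-divisorSquares (suc j) j term term-bound))
    where
    term : ℕ → Carrier
    term l = entry (D-I ⊗^ k) i l * entry D-I l j
    term-bound : ∀ l → term l ≈ 0# ⊎ suc l ∣ suc j × term l ≤ₙ suc l ℕ.* suc l
    term-bound l with D-I-entry l j
    ... | inj₁ eq         = inj₁ (trans (*-congˡ eq) (zeroʳ _))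
    ... | inj₂ (l∣j , eq) =
      inj₂ (l∣j , ≤ₙ-resp (sym (trans (*-congˡ eq) (*-identityʳ _))) (D-I-power-≤ₙ k i l))

  Z-≤ₙ : ∀ i j → entry Z i j ≤ₙ suc j ℕ.* suc j
  Z-≤ₙ i j = ≤ₙ-resp (sym (Z-power i j)) (D-I-power-≤ₙ (v₂ (suc i)) (pred (oddPart (suc i))) j)

  P-entry : ∀ i j → entry P i j ≈ sign i * sign j * entry Z i j
  P-entry i j = begin
    entry P i j                         ≈⟨ ⊗-diagonal Y sign i j ⟩
    entry Y i j * sign j                ≈⟨ *-congʳ (diagonal-⊗ sign Z i j) ⟩
    sign i * entry Z i j * sign j       ≈⟨ *-assoc _ _ _ ⟩
    sign i * (entry Z i j * sign j)     ≈⟨ *-congˡ (*-comm _ _) ⟩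
    sign i * (sign j * entry Z i j)     ≈⟨ *-assoc _ _ _ ⟨
    sign i * sign j * entry Z i j       ∎

  P-vanish : ∀ {i j} → j ℕ.< i → entry P i j ≈ 0#
  P-vanish {i} {j} j<i = trans (P-entry i j) (trans (*-congˡ (vanish Z j<i)) (zeroʳ _))

  -- Conjugation by X multiplies an entry of Z by a power of -1 with exponent
  -- `v₂ (suc i) + v₂ (suc j)`.
  P-entry-±ℕ : ∀ i j → ∃[ n ] n ℕ.≤ suc j ℕ.* suc j × (entry P i j ≈ n · 1# ⊎ entry P i j ≈ - (n · 1#))
  P-entry-±ℕ i j with Z-≤ₙ i j
  ... | n , n≤j² , Z≈n = n , n≤j² , signed ([-1]^n≈±1 (v₂ (suc i) ℕ.+ v₂ (suc j)))
    where
    P≈ : ∀ {s} → (- 1#) ^ (v₂ (suc i) ℕ.+ v₂ (suc j)) ≈ s → entry P i j ≈ s * (n · 1#)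
    P≈ eq = trans (P-entry i j)
      (*-cong (trans (sym (^-homo-* (- 1#) (v₂ (suc i)) (v₂ (suc j)))) eq) Z≈n)
    signed : (- 1#) ^ (v₂ (suc i) ℕ.+ v₂ (suc j)) ≈ 1# ⊎ (- 1#) ^ (v₂ (suc i) ℕ.+ v₂ (suc j)) ≈ - 1# →
             entry P i j ≈ n · 1# ⊎ entry P i j ≈ - (n · 1#)
    signed (inj₁ eq) = inj₁ (trans (P≈ eq) (*-identityˡ _))
    signed (inj₂ eq) = inj₂ (trans (P≈ eq) (-1*x≈-x _))

-- Growth over the complex scalars.

module Growth {c ℓ₁ ℓ₂} (R : OrderedRing c ℓ₁ ℓ₂) where

  open OrderedRing R
  open Complex R
  open DivisorMatrix ℂ using (P; P-vanish; P-entry-±ℕ)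
  open SemiringExp semiring using (_^_)
  open SemiringMult semiring using (×-homo-+; ×1-homo-*)
  open RingProperties ring using (-‿distribˡ-*; -‿distribʳ-*; -‿involutive; -0#≈0#)
  open IsPartialOrder isPartialOrder
    using (antisym; ≤-respˡ-≈; ≤-respʳ-≈)
    renaming (refl to ≤-refl; trans to ≤-trans)
  private module ℂ = CommutativeRing ℂ
  open SemiringMult ℂ.semiring using () renaming (_×_ to _·ℂ_)

  0≤fromℕ : ∀ n → 0# ≤ fromℕ n
  0≤fromℕ zero    = ≤-refl
  0≤fromℕ (suc n) = ≤-trans (0≤fromℕ n) (≤-respˡ-≈ (+-identityˡ _) (+-monoˡ-≤ (fromℕ n) 0≤1))

  fromℕ-mono-≤ : ∀ {m n} → m ℕ.≤ n → fromℕ m ≤ fromℕ n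
  fromℕ-mono-≤ {m} {n} m≤n = ≤-respʳ-≈
    (trans (sym (×-homo-+ 1# (n ℕ.∸ m) m)) (reflexive (≡.cong fromℕ (ℕₚ.m∸n+n≡m m≤n))))
    (≤-respˡ-≈ (+-identityˡ _) (+-monoˡ-≤ (fromℕ m) (0≤fromℕ (n ℕ.∸ m))))

  fromℕ-square-mono-≤ : ∀ {m n} → m ℕ.≤ n → fromℕ m * fromℕ m ≤ fromℕ n * fromℕ n
  fromℕ-square-mono-≤ {m} {n} m≤n =
    ≤-respˡ-≈ (×1-homo-* m m) (≤-respʳ-≈ (×1-homo-* n n) (fromℕ-mono-≤ (ℕₚ.*-mono-≤ m≤n m≤n)))

  fromℕ-ℂ : ∀ n → n ·ℂ ℂ.1# ℂ.≈ (fromℕ n , 0#)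
  fromℕ-ℂ zero    = refl , refl
  fromℕ-ℂ (suc n) with fromℕ-ℂ n
  ... | re , im = +-congˡ re , trans (+-identityˡ _) im

  ∣±n∣≤ : ∀ {z n b} → n ℕ.≤ b → z ℂ.≈ n ·ℂ ℂ.1# ⊎ z ℂ.≈ ℂ.- (n ·ℂ ℂ.1#) → ∣ z ∣≤ fromℕ b
  ∣±n∣≤ {x , y} {n} {b} n≤b z≈±n = 0≤fromℕ b , ≤-respˡ-≈ (sym (norm z≈±n)) (fromℕ-square-mono-≤ n≤b)
    where
    re = proj₁ (fromℕ-ℂ n)
    im = proj₂ (fromℕ-ℂ n)
    norm : (x , y) ℂ.≈ n ·ℂ ℂ.1# ⊎ (x , y) ℂ.≈ ℂ.- (n ·ℂ ℂ.1#) → x * x + y * y ≈ fromℕ n * fromℕ n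
    norm (inj₁ (x≈ , y≈)) = trans
      (+-cong (*-cong (trans x≈ re) (trans x≈ re)) (trans (*-congʳ (trans y≈ im)) (zeroˡ _)))
      (+-identityʳ _)
    norm (inj₂ (x≈ , y≈)) = trans
      (+-cong (trans (*-cong x≈-n x≈-n) neg²) (trans (*-congʳ (trans y≈ (trans (-‿cong im) -0#≈0#))) (zeroˡ _)))
      (+-identityʳ _)
      where
      x≈-n = trans x≈ (-‿cong re)
      neg² : - fromℕ n * - fromℕ n ≈ fromℕ n * fromℕ n
      neg² = trans (sym (-‿distribˡ-* _ _)) (trans (-‿cong (sym (-‿distribʳ-* _ _))) (-‿involutive _))

  ∣∣≤-resp : ∀ {z w r t} → z ℂ.≈ w → r ≈ t → ∣ z ∣≤ r → ∣ w ∣≤ t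
  ∣∣≤-resp (x≈ , y≈) r≈t (0≤r , z≤r) =
    ≤-respʳ-≈ r≈t 0≤r ,
    ≤-respˡ-≈ (+-cong (*-cong x≈ x≈) (*-cong y≈ y≈)) (≤-respʳ-≈ (*-cong r≈t r≈t) z≤r)

  DR₀-≋P : ∀ W → W ≋ P → DR₀ W
  -- C = 1 and exponent 2 serve both conditions: entries are at most j² in absolute value, and i >
  -- j² forces i > j, below the diagonal.
  DR₀-≋P W W≋P = 1# , 2 , (0≤1 , 0≉1) , s≤s z≤n , λ i j → zero-below i j , bounded i j
    where
    square : ∀ j → fromℕ (suc j ℕ.* suc j) ≈ 1# * fromℕ (suc j) ^ 2
    square j = trans (×1-homo-* (suc j) (suc j))
      (sym (trans (*-identityˡ _) (*-congˡ (*-identityʳ _))))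

    zero-below : ∀ i j → 1# * fromℕ (suc j) ^ 2 < fromℕ (suc i) → entry W i j ℂ.≈ ℂ.0#
    zero-below i j (j²≤i , j²≉i) with j ℕₚ.<? i
    ... | yes j<i = ℂ.trans {entry W i j} {entry P i j} {ℂ.0#} (W≋P i j) (P-vanish j<i)
    -- Strict order means ≤ together with ≉, so i ≤ j ≤ j² is refuted by antisymmetry.
    ... | no  j≮i = contradiction (antisym j²≤i (≤-respʳ-≈ (square j) (fromℕ-mono-≤ i≤j²))) j²≉i
      where
      i≤j² : suc i ℕ.≤ suc j ℕ.* suc j
      i≤j² = ℕₚ.≤-trans (s≤s (ℕₚ.≮⇒≥ j≮i)) (ℕₚ.m≤m*n (suc j) (suc j))

    bounded : ∀ i j → ∣ entry W i j ∣≤ (1# * fromℕ (suc j) ^ 2)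
    bounded i j with P-entry-±ℕ i j
    ... | n , n≤j² , P≈±n =
      ∣∣≤-resp (ℂ.sym {entry W i j} {entry P i j} (W≋P i j)) (square j) (∣±n∣≤ n≤j² P≈±n)

theorem4p6 : ∀ {c ℓ₁ ℓ₂ : Level} (R : OrderedRing c ℓ₁ ℓ₂) →
    let open Complex R in
    IsInverse Z (X ⊗ Z ⊗ X)
    × (∀ W → IsInverse Z W → W ≋ X ⊗ Z ⊗ X)
    × (∀ W → IsInverse Z W → DR₀ W)
theorem4p6 R = P-inverse , inverse≋P , λ W inv → DR₀-≋P W (inverse≋P W inv)
  where
  open Complex R using (ℂ)
  open DivisorMatrix ℂ
  open Growth R
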